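{- Let $n \geq 1$ and fix integers $\lambda_2 \geq \lambda_3 \geq \cdots \geq \lambda_n \geq 0$. For integers $\lambda_1 \geq \lambda_2$ let $\lambda = (\lambda_1, \lambda_2, \ldots, \lambda_n)$. Then $A_\lambda(n)$, regarded as a function of $\lambda_1$, is a polynomial in $\lambda_1$ of degree $n-1$.
   Context: Six-vertex model: on an $r \times c$ grid there are $r$ horizontal lines and $c$ vertical lines meeting in $rc$ vertices. Each horizontal line consists of $c+1$ edges (the outermost ones are a left and a right boundary edge) and each vertical line of $r+1$ edges (the outermost ones are a top and a bottom boundary edge). A state assigns an orientation to every edge (left/right for horizontal edges, up/down for vertical edges), agreeing with prescribed orientations on the boundary edges, such that at every vertex exactly two of the four adjacent edges point into the vertex and two point out of it. For a partition $\lambda = (\lambda_1, \ldots, \lambda_n)$ (integers $\lambda_1 \geq \cdots \geq \lambda_n \geq 0$), $A_\lambda(n)$ is the number of states of the six-vertex model on the grid with $n$ rows and $n + \lambda_1$ columns with boundary conditions: all left boundary arrows point right, all right boundary arrows point left, all bottom boundary arrows point down, and, numbering the columns $1, 2, \ldots, n+\lambda_1$ from right to left, the top boundary arrow in column $i$ points up if $i \in \{\lambda_k + n + 1 - k : 1 \leq k \leq n\}$ and down otherwise. -}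

module Defs where

open import Data.Fin using (Fin; zero; suc; toℕ; fromℕ; inject₁)
open import Data.Fin.Properties using (all?; any?)
open import Data.Integer using (+_)
open import Data.List using (List; []; _∷_; cartesianProductWith; filter; length)
open import Data.List.Membership.Propositional using (_∈_)
open import Data.List.Membership.Propositional.Properties
  using (∈-cartesianProductWith⁺)
import Data.List.Relation.Unary.All as All
import Data.List.Relation.Unary.AllPairs as AllPairs
open import Data.List.Relation.Unary.Any using (here; there)
open import Data.List.Relation.Unary.Unique.Propositional using (Unique)
open import Data.List.Relation.Unary.Unique.Propositional.Properties
  using (cartesianProductWith⁺)
open import Data.Nat using (ℕ; zero; suc; _+_; _∸_; _≥_)
import Data.Nat.Properties as ℕₚ
open import Data.Product using (_,_)
open import Data.Rational as ℚ using (ℚ; 0ℚ)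
open import Data.Vec using (Vec; []; _∷_; foldr; head; last; lookup)
open import Data.Vec.Properties using (∷-injective)
open import Data.Vec.Relation.Unary.Linked using (Linked)
open import Relation.Binary.Definitions using (DecidableEquality)
open import Relation.Binary.PropositionalEquality using (_≡_; _≢_; refl)
open import Relation.Nullary.Decidable
  using (Dec; yes; no; does; map′; _×-dec_)
open import Data.Bool using (if_then_else_)

IsPartition : ∀ {n} → Vec ℕ n → Set
IsPartition = Linked _≥_

data Horizontal : Set where
  left right : Horizontal

data Vertical : Set where
  up down : Vertical

_≟ʰ_ : DecidableEquality Horizontal
left  ≟ʰ left  = yes refl
left  ≟ʰ right = no λ ()
right ≟ʰ left  = no λ ()
right ≟ʰ right = yes refl

_≟ᵛ_ : DecidableEquality Vertical
up   ≟ᵛ up   = yes refl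
up   ≟ᵛ down = no λ ()
down ≟ᵛ up   = no λ ()
down ≟ᵛ down = yes refl

-- Rows are indexed from top to bottom and columns from left to right,
-- starting at 0.  The vertex in row i and column j lies between the
-- horizontal edges j and j + 1 of row i, and between the vertical edges
-- i and i + 1 of column j.
record Configuration (r c : ℕ) : Set where
  constructor configuration
  field
    horizontals : Vec (Vec Horizontal (suc c)) r
    verticals   : Vec (Vec Vertical c) (suc r)

  horizontal : Fin r → Fin (suc c) → Horizontal
  horizontal i j = lookup (lookup horizontals i) j

  vertical : Fin (suc r) → Fin c → Vertical
  vertical i j = lookup (lookup verticals i) j

  leftOf rightOf : Fin r → Fin c → Horizontal
  leftOf  i j = horizontal i (inject₁ j)
  rightOf i j = horizontal i (suc j)

  above below : Fin r → Fin c → Vertical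
  above i j = vertical (inject₁ i) j
  below i j = vertical (suc i) j

-- The number (0 or 1) of arrows pointing into a vertex from the edge on
-- the given side of it.
inFromLeft inFromRight : Horizontal → ℕ
inFromLeft right = 1
inFromLeft left  = 0
inFromRight left  = 1
inFromRight right = 0

inFromAbove inFromBelow : Vertical → ℕ
inFromAbove down = 1
inFromAbove up   = 0
inFromBelow up   = 1
inFromBelow down = 0

indegree : ∀ {r c} → Configuration r c → Fin r → Fin c → ℕ
indegree s i j =
  inFromLeft (leftOf i j) + inFromRight (rightOf i j)
  + inFromAbove (above i j) + inFromBelow (below i j)
  where open Configuration s

columns : ∀ {m} → Vec ℕ (suc m) → ℕ
columns {m} λs = suc m + head λs

-- The column number counted from right to left, from 1 to c.
columnNumber : ∀ {c} → Fin c → ℕ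
columnNumber {c} j = c ∸ toℕ j

-- With k = toℕ i + 1, the number λₖ + n + 1 - k.
upColumn : ∀ {n} → Vec ℕ n → Fin n → ℕ
upColumn {n} λs i = lookup λs i + (n ∸ toℕ i)

topArrow : ∀ {m} (λs : Vec ℕ (suc m)) → Fin (columns λs) → Vertical
topArrow λs j =
  if does (any? λ i → columnNumber j ℕₚ.≟ upColumn λs i) then up else down

record IsState {m} (λs : Vec ℕ (suc m))
               (s : Configuration (suc m) (columns λs)) : Set where
  open Configuration s
  field
    leftBoundary   : ∀ i → horizontal i zero ≡ right
    rightBoundary  : ∀ i → horizontal i (fromℕ (columns λs)) ≡ left
    topBoundary    : ∀ j → vertical zero j ≡ topArrow λs j
    bottomBoundary : ∀ j → vertical (fromℕ (suc m)) j ≡ down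
    iceRule        : ∀ i j → indegree s i j ≡ 2

isState? : ∀ {m} (λs : Vec ℕ (suc m))
           (s : Configuration (suc m) (columns λs)) → Dec (IsState λs s)
isState? {m} λs s = map′
  (λ (l , r , t , b , ice) → record
    { leftBoundary = l ; rightBoundary = r ; topBoundary = t
    ; bottomBoundary = b ; iceRule = ice })
  (λ p → let open IsState p in
    leftBoundary , rightBoundary , topBoundary , bottomBoundary , iceRule)
  (      all? (λ i → horizontal i zero ≟ʰ right)
  ×-dec all? (λ i → horizontal i (fromℕ (columns λs)) ≟ʰ left)
  ×-dec all? (λ j → vertical zero j ≟ᵛ topArrow λs j)
  ×-dec all? (λ j → vertical (fromℕ (suc m)) j ≟ᵛ down)
  ×-dec all? (λ i → all? λ j → indegree s i j ℕₚ.≟ 2))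
  where open Configuration s

allVectors : ∀ {A : Set} → List A → (n : ℕ) → List (Vec A n)
allVectors xs zero    = [] ∷ []
allVectors xs (suc n) = cartesianProductWith _∷_ xs (allVectors xs n)

allConfigurations : ∀ r c → List (Configuration r c)
allConfigurations r c = cartesianProductWith configuration
  (allVectors (allVectors (left ∷ right ∷ []) (suc c)) r)
  (allVectors (allVectors (up ∷ down ∷ []) c) (suc r))

-- A λs is A_λ(n) for λs = (λ₁, …, λₙ), n = m + 1.
A : ∀ {m} → Vec ℕ (suc m) → ℕ
A {m} λs = length (filter (isState? λs) (allConfigurations (suc m) (columns λs)))

-- Each configuration is listed exactly once, so A counts the states.

allVectors-complete : ∀ {A : Set} {xs : List A} → (∀ x → x ∈ xs) →
                      ∀ {n} (v : Vec A n) → v ∈ allVectors xs n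
allVectors-complete all []      = here refl
allVectors-complete all (x ∷ v) =
  ∈-cartesianProductWith⁺ _∷_ (all x) (allVectors-complete all v)

allVectors-unique : ∀ {A : Set} {xs : List A} → Unique xs →
                    ∀ n → Unique (allVectors xs n)
allVectors-unique xs! zero    = All.[] AllPairs.∷ AllPairs.[]
allVectors-unique xs! (suc n) =
  cartesianProductWith⁺ _∷_ ∷-injective xs! (allVectors-unique xs! n)

allConfigurations-complete : ∀ {r c} (s : Configuration r c) →
                             s ∈ allConfigurations r c
allConfigurations-complete (configuration hs vs) =
  ∈-cartesianProductWith⁺ configuration
    (allVectors-complete (allVectors-complete
      λ { left → here refl ; right → there (here refl) }) hs)
    (allVectors-complete (allVectors-complete
      λ { up → here refl ; down → there (here refl) }) vs)

allConfigurations-unique : ∀ r c → Unique (allConfigurations r c)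
allConfigurations-unique r c =
  cartesianProductWith⁺ configuration (λ { refl → refl , refl })
    (allVectors-unique (allVectors-unique
      (((λ ()) All.∷ All.[]) AllPairs.∷ All.[] AllPairs.∷ AllPairs.[]) (suc c)) r)
    (allVectors-unique (allVectors-unique
      (((λ ()) All.∷ All.[]) AllPairs.∷ All.[] AllPairs.∷ AllPairs.[]) c) (suc r))

-- Coefficients are listed in order of increasing powers.
record PolynomialOfDegree (d : ℕ) : Set where
  field
    coefficients : Vec ℚ (suc d)
    leading≢0    : last coefficients ≢ 0ℚ

evaluate : ∀ {d} → PolynomialOfDegree d → ℚ → ℚ
evaluate p x = foldr (λ _ → ℚ) (λ a y → a ℚ.+ x ℚ.* y) 0ℚ coefficients
  where open PolynomialOfDegree p

fromℕ-ℚ : ℕ → ℚ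
fromℕ-ℚ n = + n ℚ./ 1

{-# OPTIONS --safe #-}

-- Count states row by row with a transfer operator.  Put k = λ₁ + m - w,
-- where w is the column number of the leftmost up arrow prescribed by μ (0
-- if m = 0); then the top boundary reads up, k times down, and a word
-- depending only on μ.  Below the initial segment up, down, …, down of a row
-- there is either a segment with a single up in any of its k + 1 positions,
-- or only downs.  Columns of downs to the left of all ups do not matter, so
-- with one more row the count becomes a constant plus a sum over i ≤ k of
-- the previous count at i.  Hence the count is a combination of m + 1
-- binomial coefficients multichoose (k + 1) j, j ≤ m, with natural
-- coefficients, the last of which is positive because m ups can be removed
-- one at a time.
module Submission where

open import Defs
open import Data.Bool using (if_then_else_)
open import Data.Fin using (Fin; zero; suc; fromℕ; inject₁)
open import Data.Fin.Properties using (all?; any?)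
import Data.Integer as ℤ
import Data.Integer.Properties as ℤₚ
open import Data.List as List
  using (List; []; _∷_; _++_; cartesianProductWith; filter; length; replicate)
import Data.List.Properties as Listₚ
open import Data.Nat using (ℕ; zero; suc; _+_; _*_; _∸_; _≤_; _<_; z≤n; s≤s; s≤s⁻¹)
open import Data.Nat.ListAction using (sum)
open import Data.Nat.ListAction.Properties using (sum-++)
import Data.Nat.Properties as ℕₚ
open import Data.Nat.Tactic.RingSolver using (solve-∀)
open import Data.Product using (∃; Σ-syntax; _×_; _,_)
open import Data.Rational as ℚ using (ℚ; 0ℚ; 1ℚ)
import Data.Rational.Properties as ℚₚ
open import Data.Rational.Solver using (module +-*-Solver)
import Data.Rational.Unnormalised as ℚᵘ
import Data.Rational.Unnormalised.Properties as ℚᵘₚ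
open import Data.Vec as Vec using (Vec; []; _∷_; last; lookup; tabulate; toList)
import Data.Vec.Relation.Unary.Linked as Linked
open Linked using ([-]; _∷_)
open import Function using (_∘_; _⇔_; const; mk⇔)
open import Relation.Binary.PropositionalEquality
  using (_≡_; _≢_; refl; sym; trans; cong; cong₂; subst; module ≡-Reasoning)
open import Relation.Nullary using (contradiction)
open import Relation.Nullary.Decidable
  using (Dec; yes; no; does; _×-dec_; dec-true; dec-false; does-⇔)

private
  variable
    X Y Z P Q : Set

-- Finite sums over lists and indicators of decidable propositions.

interchange : ∀ a b c d → a + b + (c + d) ≡ a + c + (b + d)
interchange = solve-∀

a+0+0≡a : ∀ a → a + 0 + 0 ≡ a
a+0+0≡a = solve-∀

∑ : List X → (X → ℕ) → ℕ
∑ xs f = sum (List.map f xs)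

∑-cong : ∀ (xs : List X) {f g : X → ℕ} → (∀ x → f x ≡ g x) → ∑ xs f ≡ ∑ xs g
∑-cong xs eq = cong sum (Listₚ.map-cong eq xs)

∑-+ : ∀ (xs : List X) (f g : X → ℕ) → ∑ xs (λ x → f x + g x) ≡ ∑ xs f + ∑ xs g
∑-+ []       f g = refl
∑-+ (x ∷ xs) f g = trans (cong (f x + g x +_) (∑-+ xs f g))
                         (interchange (f x) (g x) (∑ xs f) (∑ xs g))

∑-zero : ∀ (xs : List X) → ∑ xs (const 0) ≡ 0
∑-zero []       = refl
∑-zero (_ ∷ xs) = ∑-zero xs

∑-*ˡ : ∀ (xs : List X) a (f : X → ℕ) → ∑ xs (λ x → a * f x) ≡ a * ∑ xs f
∑-*ˡ []       a f = sym (ℕₚ.*-zeroʳ a)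
∑-*ˡ (x ∷ xs) a f = trans (cong (a * f x +_) (∑-*ˡ xs a f))
                          (sym (ℕₚ.*-distribˡ-+ a (f x) (∑ xs f)))

∑-swap : ∀ (xs : List X) (ys : List Y) (f : X → Y → ℕ) →
         ∑ xs (λ x → ∑ ys (f x)) ≡ ∑ ys (λ y → ∑ xs (λ x → f x y))
∑-swap []       ys f = sym (∑-zero ys)
∑-swap (x ∷ xs) ys f =
  trans (cong (∑ ys (f x) +_) (∑-swap xs ys f)) (sym (∑-+ ys (f x) _))

∑-cartesianProductWith : ∀ (c : X → Y → Z) xs ys (f : Z → ℕ) →
  ∑ (cartesianProductWith c xs ys) f ≡ ∑ xs (λ x → ∑ ys (λ y → f (c x y)))
∑-cartesianProductWith c []       ys f = refl
∑-cartesianProductWith c (x ∷ xs) ys f = begin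
  sum (List.map f (List.map (c x) ys ++ rest))
    ≡⟨ cong sum (Listₚ.map-++ f (List.map (c x) ys) rest) ⟩
  sum (List.map f (List.map (c x) ys) ++ List.map f rest)
    ≡⟨ sum-++ (List.map f (List.map (c x) ys)) _ ⟩
  ∑ (List.map (c x) ys) f + ∑ rest f
    ≡⟨ cong₂ _+_ (cong sum (sym (Listₚ.map-∘ ys))) (∑-cartesianProductWith c xs ys f) ⟩
  ∑ ys (λ y → f (c x y)) + ∑ xs (λ x → ∑ ys (λ y → f (c x y))) ∎
  where
  open ≡-Reasoning
  rest = cartesianProductWith c xs ys

∑-allVectors-suc : ∀ (xs : List X) n (f : Vec X (suc n) → ℕ) →
  ∑ (allVectors xs (suc n)) f ≡ ∑ xs (λ x → ∑ (allVectors xs n) (λ v → f (x ∷ v)))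
∑-allVectors-suc xs n f = ∑-cartesianProductWith _∷_ xs (allVectors xs n) f

𝟙 : Dec P → ℕ
𝟙 d = if does d then 1 else 0

𝟙-⇔ : (d : Dec P) (e : Dec Q) → P ⇔ Q → 𝟙 d ≡ 𝟙 e
𝟙-⇔ d e eqv = cong (if_then 1 else 0) (does-⇔ eqv d e)

𝟙-× : (d : Dec P) (e : Dec Q) → 𝟙 (d ×-dec e) ≡ 𝟙 d * 𝟙 e
𝟙-× (yes _) e = sym (ℕₚ.*-identityˡ (𝟙 e))
𝟙-× (no _)  e = refl

length-filter : ∀ {P : X → Set} (P? : ∀ x → Dec (P x)) xs →
                length (filter P? xs) ≡ ∑ xs (λ x → 𝟙 (P? x))
length-filter P? []       = refl
length-filter P? (x ∷ xs) with P? x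
... | yes _ = cong suc (length-filter P? xs)
... | no _  = length-filter P? xs

-- Counting states through row transfers.

Hs : List Horizontal
Hs = left ∷ right ∷ []

Vs : List Vertical
Vs = up ∷ down ∷ []

-- transfer h w f is the sum of f w′ over all rows of vertices with
-- vertical edges w above and w′ below, leftmost edge h and rightmost edge
-- left: the ice rule leaves at most two choices at every vertex.
transfer : Horizontal → List Vertical → (List Vertical → ℕ) → ℕ
transfer left  []         f = f []
transfer right []         f = 0
transfer left  (up ∷ w)   f = transfer left w (f ∘ (up ∷_))
transfer left  (down ∷ w) f = transfer left w (f ∘ (down ∷_)) + transfer right w (f ∘ (up ∷_))
transfer right (up ∷ w)   f = transfer left w (f ∘ (down ∷_)) + transfer right w (f ∘ (up ∷_))
transfer right (down ∷ w) f = transfer right w (f ∘ (down ∷_))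

-- The number of ways to fill `r` rows of vertices below the vertical edges `w` under the left,
-- right and bottom boundary conditions of `IsState`.
states : ℕ → List Vertical → ℕ
states zero    []         = 1
states zero    (up ∷ w)   = 0
states zero    (down ∷ w) = states zero w
states (suc r) w          = transfer right w (states r)

-- The leftmost edge is not prescribed, since induction along the columns meets both of its values.
Row : ∀ {c} → Vec Horizontal (suc c) → Vec Vertical c → Vec Vertical c → Set
Row {c} hs v v′ = lookup hs (fromℕ c) ≡ left ×
  (∀ j → inFromLeft (lookup hs (inject₁ j)) + inFromRight (lookup hs (suc j))
         + inFromAbove (lookup v j) + inFromBelow (lookup v′ j) ≡ 2)

row? : ∀ {c} hs (v v′ : Vec Vertical c) → Dec (Row hs v v′)
row? hs v v′ = (_ ≟ʰ left) ×-dec all? λ j → _ ℕₚ.≟ 2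

ice? : ∀ h h′ x y →
       Dec (inFromLeft h + inFromRight h′ + inFromAbove x + inFromBelow y ≡ 2)
ice? h h′ x y = _ ℕₚ.≟ 2

Row-∷ : ∀ {c} h h′ (hs : Vec Horizontal c) x y v v′ →
  Row (h ∷ h′ ∷ hs) (x ∷ v) (y ∷ v′) ⇔
  (inFromLeft h + inFromRight h′ + inFromAbove x + inFromBelow y ≡ 2 × Row (h′ ∷ hs) v v′)
Row-∷ h h′ hs x y v v′ = mk⇔
  (λ (l , ice) → ice zero , l , λ j → ice (suc j))
  (λ (i , l , ice) → l , λ { zero → i ; (suc j) → ice j })

-- Induction along the row: the ice rule at the first vertex splits off as an indicator in `h`,
-- `h′`, `x`, `y`, and the rest of the row gives the same sum starting with `h′`.
∑-row : ∀ {c} h (v : Vec Vertical c) (f : List Vertical → ℕ) →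
  ∑ (allVectors Hs c) (λ hs → ∑ (allVectors Vs c) (λ v′ →
    𝟙 (row? (h ∷ hs) v v′) * f (toList v′))) ≡ transfer h (toList v) f
∑-row left  [] f = trans (ℕₚ.+-identityʳ _) (a+0+0≡a (f []))
∑-row right [] f = refl
∑-row {suc c} h (x ∷ v) f = begin
  ∑ (allVectors Hs (suc c)) (λ hs → ∑ (allVectors Vs (suc c)) (λ v′ →
    𝟙 (row? (h ∷ hs) (x ∷ v) v′) * f (toList v′)))
    ≡⟨ ∑-allVectors-suc Hs c _ ⟩
  ∑ Hs (λ h′ → ∑ (allVectors Hs c) (λ hs → ∑ (allVectors Vs (suc c)) (λ v′ →
    𝟙 (row? (h ∷ h′ ∷ hs) (x ∷ v) v′) * f (toList v′))))
    ≡⟨ ∑-cong Hs (λ h′ → trans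
         (∑-cong (allVectors Hs c) (λ hs → ∑-allVectors-suc Vs c (λ v′ →
           𝟙 (row? (h ∷ h′ ∷ hs) (x ∷ v) v′) * f (toList v′))))
         (trans (∑-swap (allVectors Hs c) Vs (λ hs y → ∑ (allVectors Vs c) (λ v′ →
                  𝟙 (row? (h ∷ h′ ∷ hs) (x ∷ v) (y ∷ v′)) * f (y ∷ toList v′))))
                (∑-cong Vs (step h′)))) ⟩
  ∑ Hs (λ h′ → ∑ Vs (λ y → 𝟙 (ice? h h′ x y) * transfer h′ (toList v) (f ∘ (y ∷_))))
    ≡⟨ collect h x ⟩
  transfer h (x ∷ toList v) f ∎
  where
  open ≡-Reasoning

  step : ∀ h′ y →
    ∑ (allVectors Hs c) (λ hs → ∑ (allVectors Vs c) (λ v′ →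
      𝟙 (row? (h ∷ h′ ∷ hs) (x ∷ v) (y ∷ v′)) * f (y ∷ toList v′)))
    ≡ 𝟙 (ice? h h′ x y) * transfer h′ (toList v) (f ∘ (y ∷_))
  step h′ y = begin
    _ ≡⟨ ∑-cong (allVectors Hs c) (λ hs → trans
           (∑-cong (allVectors Vs c) (λ v′ → trans
             (cong (_* f (y ∷ toList v′)) (trans
               (𝟙-⇔ (row? (h ∷ h′ ∷ hs) (x ∷ v) (y ∷ v′)) (ice? h h′ x y ×-dec row? (h′ ∷ hs) v v′)
                 (Row-∷ h h′ hs x y v v′))
               (𝟙-× (ice? h h′ x y) (row? (h′ ∷ hs) v v′))))
             (ℕₚ.*-assoc (𝟙 (ice? h h′ x y)) _ _)))
           (∑-*ˡ (allVectors Vs c) (𝟙 (ice? h h′ x y)) _)) ⟩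
    _ ≡⟨ ∑-*ˡ (allVectors Hs c) (𝟙 (ice? h h′ x y)) _ ⟩
    _ ≡⟨ cong (𝟙 (ice? h h′ x y) *_) (∑-row h′ v (f ∘ (y ∷_))) ⟩
    _ ∎

  one : ∀ a → 1 * a + 0 + 0 ≡ a
  one = solve-∀

  two : ∀ a b → 1 * a + 0 + (1 * b + 0 + 0) ≡ a + b
  two = solve-∀

  -- For each `h` and `x` the four indicators evaluate; those equal to 1 are the choices listed in
  -- `transfer`.
  collect : ∀ h x →
    ∑ Hs (λ h′ → ∑ Vs (λ y → 𝟙 (ice? h h′ x y) * transfer h′ (toList v) (f ∘ (y ∷_))))
    ≡ transfer h (x ∷ toList v) f
  collect left  up   = one _
  collect left  down = two _ (transfer right (toList v) (f ∘ (up ∷_)))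
  collect right up   = two _ (transfer right (toList v) (f ∘ (up ∷_)))
  collect right down = one _

∑-boundedRow : ∀ {c} (v : Vec Vertical c) (f : List Vertical → ℕ) →
  ∑ (allVectors Hs (suc c)) (λ hs → ∑ (allVectors Vs c) (λ v′ →
    𝟙 ((lookup hs zero ≟ʰ right) ×-dec row? hs v v′) * f (toList v′)))
  ≡ transfer right (toList v) f
∑-boundedRow {c} v f = begin
  _ ≡⟨ ∑-allVectors-suc Hs c _ ⟩
  _ ≡⟨ cong₂ (λ a b → a + (b + 0))
         (trans (∑-cong (allVectors Hs c) (λ hs → ∑-zero (allVectors Vs c)))
                (∑-zero (allVectors Hs c)))
         (∑-row right v f) ⟩
  _ ≡⟨ ℕₚ.+-identityʳ _ ⟩
  _ ∎
  where open ≡-Reasoning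

-- The conditions of IsState apart from topBoundary, the top row being v.
Rows : ∀ {r c} → Vec (Vec Horizontal (suc c)) r → Vec Vertical c →
       Vec (Vec Vertical c) r → Set
Rows {r} {c} hs v vs =
    (∀ i → horizontal i zero ≡ right)
  × (∀ i → horizontal i (fromℕ c) ≡ left)
  × (∀ j → vertical (fromℕ r) j ≡ down)
  × (∀ i j → indegree s i j ≡ 2)
  where
  s = configuration hs (v ∷ vs)
  open Configuration s

rows? : ∀ {r c} hs (v : Vec Vertical c) (vs : Vec _ r) → Dec (Rows hs v vs)
rows? hs v vs =
  all? (λ i → _ ≟ʰ right) ×-dec all? (λ i → _ ≟ʰ left) ×-dec
  all? (λ j → _ ≟ᵛ down) ×-dec all? (λ i → all? λ j → _ ℕₚ.≟ 2)

Rows-∷ : ∀ {r c} h (hs : Vec _ r) (v v′ : Vec Vertical c) vs →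
  Rows (h ∷ hs) v (v′ ∷ vs) ⇔
  ((lookup h zero ≡ right × Row h v v′) × Rows hs v′ vs)
Rows-∷ h hs v v′ vs = mk⇔
  (λ (l , r , b , ice) → (l zero , r zero , ice zero) ,
    (λ i → l (suc i)) , (λ i → r (suc i)) , b , λ i → ice (suc i))
  (λ ((l₀ , r₀ , ice₀) , l , r , b , ice) →
    (λ { zero → l₀ ; (suc i) → l i }) , (λ { zero → r₀ ; (suc i) → r i }) ,
    b , λ { zero → ice₀ ; (suc i) → ice i })

𝟙-allDown : ∀ {c} (v : Vec Vertical c) →
            𝟙 (all? λ j → lookup v j ≟ᵛ down) ≡ states 0 (toList v)
𝟙-allDown []         = refl
𝟙-allDown (up ∷ v)   = refl
𝟙-allDown (down ∷ v) = trans
  (𝟙-⇔ (all? λ j → lookup (down ∷ v) j ≟ᵛ down) (all? λ j → lookup v j ≟ᵛ down)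
    (mk⇔ (λ p j → p (suc j)) (λ p → λ { zero → refl ; (suc j) → p j })))
  (𝟙-allDown v)

transfer-cong : ∀ h w {f g} → (∀ w′ → f w′ ≡ g w′) → transfer h w f ≡ transfer h w g
transfer-cong left  []         eq = eq []
transfer-cong right []         eq = refl
transfer-cong left  (up ∷ w)   eq = transfer-cong left w (λ w′ → eq (up ∷ w′))
transfer-cong left  (down ∷ w) eq =
  cong₂ _+_ (transfer-cong left w (λ w′ → eq (down ∷ w′)))
            (transfer-cong right w (λ w′ → eq (up ∷ w′)))
transfer-cong right (up ∷ w)   eq =
  cong₂ _+_ (transfer-cong left w (λ w′ → eq (down ∷ w′)))
            (transfer-cong right w (λ w′ → eq (up ∷ w′)))
transfer-cong right (down ∷ w) eq = transfer-cong right w (λ w′ → eq (down ∷ w′))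

-- Fixing the top horizontal edges and the vertical edges `v′` below them leaves a sum over `r` rows
-- under `v′`, which by induction depends on `v′` only. What remains is the one-row sum of
-- `∑-boundedRow`.
∑-rows : ∀ r {c} (v : Vec Vertical c) →
  ∑ (allVectors (allVectors Hs (suc c)) r) (λ hs →
    ∑ (allVectors (allVectors Vs c) r) (λ vs → 𝟙 (rows? hs v vs)))
  ≡ states r (toList v)
∑-rows zero    v = trans (a+0+0≡a _) (trans
  (𝟙-⇔ (rows? [] v []) (all? λ j → lookup v j ≟ᵛ down)
    (mk⇔ (λ (_ , _ , b , _) → b) (λ b → (λ ()) , (λ ()) , b , λ ())))
  (𝟙-allDown v))
∑-rows (suc r) {c} v = begin
  ∑ (allVectors Hr (suc r)) (λ hs → ∑ (allVectors Vr (suc r)) (λ vs → 𝟙 (rows? hs v vs)))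
    ≡⟨ ∑-allVectors-suc Hr r _ ⟩
  ∑ Hr (λ h → ∑ (allVectors Hr r) (λ hs → ∑ (allVectors Vr (suc r)) (λ vs →
    𝟙 (rows? (h ∷ hs) v vs))))
    ≡⟨ ∑-cong Hr (λ h → trans
         (∑-cong (allVectors Hr r) (λ hs → ∑-allVectors-suc Vr r (λ vs → 𝟙 (rows? (h ∷ hs) v vs))))
         (trans (∑-swap (allVectors Hr r) Vr (λ hs v′ → ∑ (allVectors Vr r) (λ vs →
                  𝟙 (rows? (h ∷ hs) v (v′ ∷ vs))))) (∑-cong Vr (step h)))) ⟩
  ∑ Hr (λ h → ∑ Vr (λ v′ → 𝟙 (top? h v′) * states r (toList v′)))
    ≡⟨ ∑-boundedRow v (states r) ⟩
  transfer right (toList v) (states r) ∎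
  where
  open ≡-Reasoning
  Hr = allVectors Hs (suc c)
  Vr = allVectors Vs c

  top? : ∀ h v′ → Dec (lookup h zero ≡ right × Row h v v′)
  top? h v′ = (lookup h zero ≟ʰ right) ×-dec row? h v v′

  step : ∀ h v′ →
    ∑ (allVectors Hr r) (λ hs → ∑ (allVectors Vr r) (λ vs →
      𝟙 (rows? (h ∷ hs) v (v′ ∷ vs))))
    ≡ 𝟙 (top? h v′) * states r (toList v′)
  step h v′ = begin
    _ ≡⟨ ∑-cong (allVectors Hr r) (λ hs → trans
           (∑-cong (allVectors Vr r) (λ vs → trans
             (𝟙-⇔ (rows? (h ∷ hs) v (v′ ∷ vs)) (top? h v′ ×-dec rows? hs v′ vs) (Rows-∷ h hs v v′ vs))
             (𝟙-× (top? h v′) (rows? hs v′ vs))))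
           (∑-*ˡ (allVectors Vr r) (𝟙 (top? h v′)) _)) ⟩
    _ ≡⟨ ∑-*ˡ (allVectors Hr r) (𝟙 (top? h v′)) _ ⟩
    _ ≡⟨ cong (𝟙 (top? h v′) *_) (∑-rows r v′) ⟩
    _ ∎

∑-prescribed : ∀ {c} (t : Fin c → Vertical) (f : Vec Vertical c → ℕ) →
  ∑ (allVectors Vs c) (λ v → 𝟙 (all? λ j → lookup v j ≟ᵛ t j) * f v) ≡ f (tabulate t)
∑-prescribed {zero}  t f = a+0+0≡a (f [])
∑-prescribed {suc c} t f = begin
  _ ≡⟨ ∑-allVectors-suc Vs c _ ⟩
  _ ≡⟨ ∑-cong Vs step ⟩
  ∑ Vs (λ x → 𝟙 (x ≟ᵛ t zero) * f (x ∷ tabulate (t ∘ suc)))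
    ≡⟨ collect (t zero) ⟩
  _ ∎
  where
  open ≡-Reasoning

  rest? : ∀ v → Dec (∀ j → lookup v j ≡ t (suc j))
  rest? v = all? λ j → lookup v j ≟ᵛ t (suc j)

  step : ∀ x →
    ∑ (allVectors Vs c) (λ v → 𝟙 (all? λ j → lookup (x ∷ v) j ≟ᵛ t j) * f (x ∷ v))
    ≡ 𝟙 (x ≟ᵛ t zero) * f (x ∷ tabulate (t ∘ suc))
  step x = begin
    _ ≡⟨ ∑-cong (allVectors Vs c) (λ v → trans
           (cong (_* f (x ∷ v)) (trans
             (𝟙-⇔ (all? λ j → lookup (x ∷ v) j ≟ᵛ t j) ((x ≟ᵛ t zero) ×-dec rest? v)
               (mk⇔ (λ p → p zero , λ j → p (suc j))
                    (λ (p , ps) → λ { zero → p ; (suc j) → ps j })))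
             (𝟙-× (x ≟ᵛ t zero) (rest? v))))
           (ℕₚ.*-assoc (𝟙 (x ≟ᵛ t zero)) _ _)) ⟩
    _ ≡⟨ ∑-*ˡ (allVectors Vs c) (𝟙 (x ≟ᵛ t zero)) _ ⟩
    _ ≡⟨ cong (𝟙 (x ≟ᵛ t zero) *_) (∑-prescribed (t ∘ suc) (f ∘ (x ∷_))) ⟩
    _ ∎

  collect : ∀ y → ∑ Vs (λ x → 𝟙 (x ≟ᵛ y) * f (x ∷ tabulate (t ∘ suc)))
                ≡ f (y ∷ tabulate (t ∘ suc))
  collect up   = a+0+0≡a _
  collect down = a+0+0≡a _

-- The top boundary condition splits off as an indicator, and `∑-prescribed` collapses the sum over
-- top rows to the prescribed one.
A≡states : ∀ {m} (λs : Vec ℕ (suc m)) →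
           A λs ≡ states (suc m) (toList (tabulate (topArrow λs)))
A≡states {m} λs = begin
  A λs
    ≡⟨ length-filter (isState? λs) (allConfigurations (suc m) (columns λs)) ⟩
  _ ≡⟨ ∑-cartesianProductWith configuration HH (allVectors Vr (suc (suc m))) _ ⟩
  _ ≡⟨ ∑-cong HH (λ hs → ∑-allVectors-suc Vr (suc m) (λ vs → weight hs vs)) ⟩
  _ ≡⟨ ∑-swap HH Vr (λ hs v → ∑ VV (λ vs → weight hs (v ∷ vs))) ⟩
  _ ≡⟨ ∑-cong Vr step ⟩
  _ ≡⟨ ∑-prescribed (topArrow λs) (λ v → states (suc m) (toList v)) ⟩
  states (suc m) (toList (tabulate (topArrow λs))) ∎
  where
  open ≡-Reasoning
  Vr = allVectors Vs (columns λs)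
  VV = allVectors Vr (suc m)
  HH = allVectors (allVectors Hs (suc (columns λs))) (suc m)

  weight : Vec _ _ → Vec _ _ → ℕ
  weight hs vs = 𝟙 (isState? λs (configuration hs vs))

  top? : ∀ v → Dec (∀ j → lookup v j ≡ topArrow λs j)
  top? v = all? λ j → lookup v j ≟ᵛ topArrow λs j

  split : ∀ hs v vs → IsState λs (configuration hs (v ∷ vs)) ⇔
          ((∀ j → lookup v j ≡ topArrow λs j) × Rows hs v vs)
  split hs v vs = mk⇔
    (λ p → let open IsState p in
      topBoundary , leftBoundary , rightBoundary , bottomBoundary , iceRule)
    (λ (t , l , r , b , ice) → record
      { leftBoundary = l ; rightBoundary = r ; topBoundary = t
      ; bottomBoundary = b ; iceRule = ice })

  step : ∀ v → ∑ HH (λ hs → ∑ VV (λ vs → weight hs (v ∷ vs)))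
             ≡ 𝟙 (top? v) * states (suc m) (toList v)
  step v = begin
    _ ≡⟨ ∑-cong HH (λ hs → trans
           (∑-cong VV (λ vs → trans
             (𝟙-⇔ (isState? λs (configuration hs (v ∷ vs))) (top? v ×-dec rows? hs v vs) (split hs v vs))
             (𝟙-× (top? v) (rows? hs v vs))))
           (∑-*ˡ VV (𝟙 (top? v)) _)) ⟩
    _ ≡⟨ ∑-*ˡ HH (𝟙 (top? v)) _ ⟩
    _ ≡⟨ cong (𝟙 (top? v) *_) (∑-rows (suc m) v) ⟩
    _ ∎

-- Linearity of the transfer and its action on initial downs.

transfer-zero : ∀ h w → transfer h w (const 0) ≡ 0
transfer-zero left  []         = refl
transfer-zero right []         = refl
transfer-zero left  (up ∷ w)   = transfer-zero left w
transfer-zero left  (down ∷ w) = cong₂ _+_ (transfer-zero left w) (transfer-zero right w)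
transfer-zero right (up ∷ w)   = cong₂ _+_ (transfer-zero left w) (transfer-zero right w)
transfer-zero right (down ∷ w) = transfer-zero right w

transfer-+ : ∀ h w f g → transfer h w (λ w′ → f w′ + g w′) ≡ transfer h w f + transfer h w g
transfer-+ left  []         f g = refl
transfer-+ right []         f g = refl
transfer-+ left  (up ∷ w)   f g = transfer-+ left w _ _
transfer-+ left  (down ∷ w) f g = trans
  (cong₂ _+_ (transfer-+ left w (f ∘ (down ∷_)) (g ∘ (down ∷_)))
             (transfer-+ right w (f ∘ (up ∷_)) (g ∘ (up ∷_))))
  (interchange (transfer left w (f ∘ (down ∷_))) _ _ _)
transfer-+ right (up ∷ w)   f g = trans
  (cong₂ _+_ (transfer-+ left w (f ∘ (down ∷_)) (g ∘ (down ∷_)))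
             (transfer-+ right w (f ∘ (up ∷_)) (g ∘ (up ∷_))))
  (interchange (transfer left w (f ∘ (down ∷_))) _ _ _)
transfer-+ right (down ∷ w) f g = transfer-+ right w _ _

transfer-*ʳ : ∀ h w f a → transfer h w (λ w′ → f w′ * a) ≡ transfer h w f * a
transfer-*ʳ left  []         f a = refl
transfer-*ʳ right []         f a = refl
transfer-*ʳ left  (up ∷ w)   f a = transfer-*ʳ left w _ a
transfer-*ʳ left  (down ∷ w) f a = trans
  (cong₂ _+_ (transfer-*ʳ left w (f ∘ (down ∷_)) a) (transfer-*ʳ right w (f ∘ (up ∷_)) a))
  (sym (ℕₚ.*-distribʳ-+ a (transfer left w (f ∘ (down ∷_))) _))
transfer-*ʳ right (up ∷ w)   f a = trans
  (cong₂ _+_ (transfer-*ʳ left w (f ∘ (down ∷_)) a) (transfer-*ʳ right w (f ∘ (up ∷_)) a))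
  (sym (ℕₚ.*-distribʳ-+ a (transfer left w (f ∘ (down ∷_))) _))
transfer-*ʳ right (down ∷ w) f a = transfer-*ʳ right w _ a

downs : ℕ → List Vertical → List Vertical
downs k w = replicate k down ++ w

-- A right arrow meeting a down arrow is forced to continue as right and down.
transfer-downs : ∀ k w f → transfer right (downs k w) f ≡ transfer right w (f ∘ downs k)
transfer-downs zero    w f = refl
transfer-downs (suc k) w f = transfer-downs k w (f ∘ (down ∷_))

-- By the same forced vertex, a leftmost column that starts with down stays down in every row.
states-down : ∀ r w → states r (down ∷ w) ≡ states r w
states-down zero    w = refl
states-down (suc r) w = transfer-cong right w (states-down r)

-- Multiset coefficients and their linear combinations.

-- The number of multisets of size `j` from `k` kinds, that is, `k + j - 1` choose `j`; in `k` it is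
-- a polynomial of degree `j`.
multichoose : ℕ → ℕ → ℕ
multichoose k       zero    = 1
multichoose zero    (suc j) = 0
multichoose (suc k) (suc j) = multichoose k (suc j) + multichoose (suc k) j

-- The ratio of consecutive coefficients is linear in `k`, which permits the Horner form further
-- down.
multichoose-absorb : ∀ k j → suc j * multichoose k (suc j) ≡ (k + j) * multichoose k j
multichoose-absorb zero    zero    = refl
multichoose-absorb zero    (suc j) = trans (ℕₚ.*-zeroʳ j) (sym (ℕₚ.*-zeroʳ j))
multichoose-absorb (suc k) zero    = begin
  1 * (multichoose k 1 + 1) ≡⟨ ℕₚ.*-distribˡ-+ 1 (multichoose k 1) 1 ⟩
  1 * multichoose k 1 + 1   ≡⟨ cong (_+ 1) (multichoose-absorb k 0) ⟩
  (k + 0) * 1 + 1           ≡⟨ simp k ⟩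
  (suc k + 0) * 1           ∎
  where
  open ≡-Reasoning
  simp : ∀ k → (k + 0) * 1 + 1 ≡ (1 + k + 0) * 1
  simp = solve-∀
multichoose-absorb (suc k) (suc j) = begin
  suc (suc j) * (a + (c + d))
    ≡⟨ expand₁ j a (c + d) ⟩
  suc (suc j) * a + (c + d) + suc j * (c + d)
    ≡⟨ cong₂ (λ s t → s + (c + d) + t)
         (multichoose-absorb k (suc j)) (multichoose-absorb (suc k) j) ⟩
  (k + suc j) * c + (c + d) + (suc k + j) * d
    ≡⟨ expand₂ k j c d ⟩
  (suc k + suc j) * (c + d) ∎
  where
  open ≡-Reasoning
  a = multichoose k (suc (suc j))
  c = multichoose k (suc j)
  d = multichoose (suc k) j
  expand₁ : ∀ j a b → (2 + j) * (a + b) ≡ (2 + j) * a + b + (1 + j) * b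
  expand₁ = solve-∀
  expand₂ : ∀ k j c d → (k + (1 + j)) * c + (c + d) + (1 + k + j) * d
                      ≡ (1 + k + (1 + j)) * (c + d)
  expand₂ = solve-∀

-- The sum over `i ≤ d` of `a i * multichoose k (j + i)`. The offset `j` makes summation over `k` a
-- mere shift of index.
combination : ℕ → (ℕ → ℕ) → ℕ → ℕ → ℕ
combination zero    a j k = a 0 * multichoose k j
combination (suc d) a j k = a 0 * multichoose k j + combination d (a ∘ suc) (suc j) k

combination-zero : ∀ d a j → combination d a (suc j) 0 ≡ 0
combination-zero zero    a j = ℕₚ.*-zeroʳ (a 0)
combination-zero (suc d) a j =
  cong₂ _+_ (ℕₚ.*-zeroʳ (a 0)) (combination-zero d (a ∘ suc) (suc j))

-- Pascal's rule in each term: raising the offset by one gives a discrete antiderivative in `k`.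
combination-pascal : ∀ d a j k →
  combination d a (suc j) (suc k) ≡ combination d a (suc j) k + combination d a j (suc k)
combination-pascal zero    a j k = ℕₚ.*-distribˡ-+ (a 0) (multichoose k (suc j)) _
combination-pascal (suc d) a j k = trans
  (cong₂ _+_ (ℕₚ.*-distribˡ-+ (a 0) (multichoose k (suc j)) _)
             (combination-pascal d (a ∘ suc) (suc j) k))
  (interchange (a 0 * multichoose k (suc j)) _ _ _)

transfer-combination : ∀ h w d (a : List Vertical → ℕ → ℕ) j k →
  transfer h w (λ w′ → combination d (a w′) j k)
  ≡ combination d (λ i → transfer h w (λ w′ → a w′ i)) j k
transfer-combination h w zero    a j k = transfer-*ʳ h w (λ w′ → a w′ 0) (multichoose k j)
transfer-combination h w (suc d) a j k = trans
  (transfer-+ h w (λ w′ → a w′ 0 * multichoose k j)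
                  (λ w′ → combination d (a w′ ∘ suc) (suc j) k))
  (cong₂ _+_ (transfer-*ʳ h w (λ w′ → a w′ 0) (multichoose k j))
             (transfer-combination h w d (λ w′ → a w′ ∘ suc) (suc j) k))

-- Expansion of the count in the number of downs.

-- For fixed w, states r (up ∷ downs k w) is the sum over j < r of
-- coefficient r w j * multichoose (suc k) j.
coefficient : ℕ → List Vertical → ℕ → ℕ
coefficient zero    w j       = 0
coefficient (suc r) w zero    = transfer left w (states r)
coefficient (suc r) w (suc j) = transfer right w (λ w′ → coefficient r w′ j)

-- At the first down, a left arrow either passes straight through, and that column can then be
-- dropped, or an up arrow is placed below it and the remaining downs are forced.
transfer-left-suc : ∀ r k w →
  transfer left (downs (suc k) w) (states r)
  ≡ transfer left (downs k w) (states r) + transfer right w (λ w′ → states r (up ∷ downs k w′))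
transfer-left-suc r k w = cong₂ _+_
  (transfer-cong left (downs k w) (states-down r))
  (transfer-downs k w (states r ∘ (up ∷_)))

-- Induction on `r` expresses the increment in `k` as a combination with offset 0; summing it raises
-- the offset to 1, and the value at `k = 0` supplies the constant term.
transfer-left-combination : ∀ r w k →
  transfer left (downs k w) (states r) ≡ combination r (coefficient (suc r) w) 0 k
transfer-left-combination zero w zero = sym (ℕₚ.*-identityʳ _)
transfer-left-combination zero w (suc k) = begin
  transfer left (downs (suc k) w) (states 0)
    ≡⟨ transfer-left-suc 0 k w ⟩
  transfer left (downs k w) (states 0) + transfer right w (const 0)
    ≡⟨ cong₂ _+_ (transfer-left-combination zero w k) (transfer-zero right w) ⟩
  combination 0 (coefficient 1 w) 0 k + 0
    ≡⟨ ℕₚ.+-identityʳ _ ⟩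
  combination 0 (coefficient 1 w) 0 (suc k) ∎
  where open ≡-Reasoning
transfer-left-combination (suc r) w zero = sym (trans
  (cong₂ _+_ (ℕₚ.*-identityʳ _) (combination-zero r _ 0)) (ℕₚ.+-identityʳ _))
transfer-left-combination (suc r) w (suc k) = begin
  transfer left (downs (suc k) w) (states (suc r))
    ≡⟨ transfer-left-suc (suc r) k w ⟩
  transfer left (downs k w) (states (suc r))
  -- A right arrow meeting up has the same continuations as a left arrow meeting down, so
  -- `states (suc r) (up ∷ downs k w′)` unfolds to this inner transfer with `suc k` downs.
  + transfer right w (λ w′ → transfer left (downs (suc k) w′) (states r))
    ≡⟨ cong₂ _+_ (transfer-left-combination (suc r) w k) (trans
         (transfer-cong right w (λ w′ → transfer-left-combination r w′ (suc k)))
         (transfer-combination right w r (coefficient (suc r)) 0 (suc k))) ⟩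
  a 0 * 1 + combination r (a ∘ suc) 1 k + combination r (a ∘ suc) 0 (suc k)
    ≡⟨ ℕₚ.+-assoc (a 0 * 1) _ _ ⟩
  a 0 * 1 + (combination r (a ∘ suc) 1 k + combination r (a ∘ suc) 0 (suc k))
    ≡⟨ cong (a 0 * 1 +_) (sym (combination-pascal r (a ∘ suc) 0 k)) ⟩
  combination (suc r) a 0 (suc k) ∎
  where
  open ≡-Reasoning
  a = coefficient (suc (suc r)) w

-- Positivity of the leading coefficient.

ups : List Vertical → ℕ
ups []         = 0
ups (up ∷ w)   = suc (ups w)
ups (down ∷ w) = ups w

-- Left arrows along the whole row copy the vertical arrows unchanged.
transfer-left-pos : ∀ w {f} → 0 < f w → 0 < transfer left w f
transfer-left-pos []         0<f = 0<f
transfer-left-pos (up ∷ w)   0<f = transfer-left-pos w 0<f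
transfer-left-pos (down ∷ w) 0<f = ℕₚ.m≤n⇒m≤n+o _ (transfer-left-pos w 0<f)

-- Removing the first up arrow of a row is always an admissible transition.
transfer-right-pos : ∀ {r} w {f} → ups w ≡ suc r → (∀ w′ → ups w′ ≡ r → 0 < f w′) →
                     0 < transfer right w f
transfer-right-pos (up ∷ w)   eq 0<f =
  ℕₚ.m≤n⇒m≤n+o _ (transfer-left-pos w (0<f (down ∷ w) (ℕₚ.suc-injective eq)))
transfer-right-pos (down ∷ w) eq 0<f =
  transfer-right-pos w eq (λ w′ → 0<f (down ∷ w′))

states-zero-pos : ∀ w → ups w ≡ 0 → 0 < states 0 w
states-zero-pos []         eq = s≤s z≤n
states-zero-pos (down ∷ w) eq = states-zero-pos w eq

-- The coefficient unfolds to `r` nested right transfers, each able to remove one up arrow, followed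
-- by a left transfer of a row without ups.
leading-pos : ∀ r w → ups w ≡ r → 0 < coefficient (suc r) w r
leading-pos zero    w eq = transfer-left-pos w (states-zero-pos w eq)
leading-pos (suc r) w eq = transfer-right-pos w eq (leading-pos r)

-- The shape of the prescribed top row.

-- Depending on the column number alone, this allows top rows of a partition and of its tail, whose
-- grids differ in width, to be compared.
arrow : ∀ {n} → Vec ℕ n → ℕ → Vertical
arrow λs q = if does (any? λ i → q ℕₚ.≟ upColumn λs i) then up else down

topRow : ∀ {n} → Vec ℕ n → ℕ → List Vertical
topRow λs zero    = []
topRow λs (suc q) = arrow λs (suc q) ∷ topRow λs q

toList-tabulate-arrow : ∀ {n} (λs : Vec ℕ n) c →
  toList (tabulate {n = c} (λ j → arrow λs (columnNumber j))) ≡ topRow λs c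
toList-tabulate-arrow λs zero    = refl
toList-tabulate-arrow λs (suc c) = cong (arrow λs (suc c) ∷_) (toList-tabulate-arrow λs c)

-- For a nonempty partition, also the number of the leftmost up column.
width : ∀ {n} → Vec ℕ n → ℕ
width []         = 0
width λs@(_ ∷ _) = columns λs

-- The summand `n + 1 - k` in the column numbers turns weak inequalities between parts into strict
-- ones.
width-< : ∀ {n x} {λs : Vec ℕ n} → IsPartition (x ∷ λs) → width λs < width (x ∷ λs)
width-< [-]                       = s≤s z≤n
width-< {λs = _ ∷ _} (x≥y ∷ _)    = s≤s (s≤s (ℕₚ.+-monoʳ-≤ _ x≥y))

upColumn≤width : ∀ {n} {λs : Vec ℕ n} → IsPartition λs → ∀ i → upColumn λs i ≤ width λs
upColumn≤width {suc n} {x ∷ _} p zero    = ℕₚ.≤-reflexive (ℕₚ.+-comm x (suc n))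
upColumn≤width {λs = _ ∷ _}    p (suc i) =
  ℕₚ.≤-trans (upColumn≤width (Linked.tail p) i) (ℕₚ.<⇒≤ (width-< p))

arrow-up : ∀ {n} (λs : Vec ℕ n) q → ∃ (λ i → q ≡ upColumn λs i) → arrow λs q ≡ up
arrow-up λs q e = cong (if_then up else down) (dec-true (any? λ i → q ℕₚ.≟ upColumn λs i) e)

arrow-down : ∀ {n} {λs : Vec ℕ n} → IsPartition λs → ∀ {q} → width λs < q → arrow λs q ≡ down
arrow-down {λs = λs} p {q} w<q = cong (if_then up else down)
  (dec-false (any? λ i → q ℕₚ.≟ upColumn λs i)
    (λ (i , eq) → ℕₚ.<⇒≱ w<q (subst (_≤ width λs) (sym eq) (upColumn≤width p i))))

-- The new part `x` prescribes only the up arrow in column `width (x ∷ λs)`, which `q<w` excludes.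
arrow-∷ : ∀ {n} x (λs : Vec ℕ n) {q} → q < width (x ∷ λs) → arrow (x ∷ λs) q ≡ arrow λs q
arrow-∷ {n} x λs {q} q<w = cong (if_then up else down) (does-⇔
  (mk⇔ (λ { (zero , eq) → contradiction (trans eq (ℕₚ.+-comm x (suc n))) (ℕₚ.<⇒≢ q<w)
          ; (suc i , eq) → i , eq })
       (λ (i , eq) → suc i , eq))
  (any? λ i → q ℕₚ.≟ upColumn (x ∷ λs) i)
  (any? λ i → q ℕₚ.≟ upColumn λs i))

topRow-∷ : ∀ {n} x (λs : Vec ℕ n) {q} → q < width (x ∷ λs) → topRow (x ∷ λs) q ≡ topRow λs q
topRow-∷ x λs {zero}  q<w = refl
topRow-∷ x λs {suc q} q<w = cong₂ _∷_ (arrow-∷ x λs q<w) (topRow-∷ x λs (ℕₚ.<⇒≤ q<w))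

topRow-downs : ∀ {n} {λs : Vec ℕ n} → IsPartition λs → ∀ k →
               topRow λs (k + width λs) ≡ downs k (topRow λs (width λs))
topRow-downs p zero    = refl
topRow-downs p (suc k) =
  cong₂ _∷_ (arrow-down p (s≤s (ℕₚ.m≤n+m _ k))) (topRow-downs p k)

-- The number of downs between the first two ups, or after the only up if `m = 0`. For partitions
-- the subtraction does not truncate.
gap : ∀ {m} → ℕ → Vec ℕ m → ℕ
gap {m} x μ = m + x ∸ width μ

gap-width : ∀ {m x} {μ : Vec ℕ m} → IsPartition (x ∷ μ) → gap x μ + width μ ≡ m + x
gap-width p = ℕₚ.m∸n+n≡m (s≤s⁻¹ (width-< p))

topRow-width : ∀ {m x} {μ : Vec ℕ m} → IsPartition (x ∷ μ) →
  topRow (x ∷ μ) (width (x ∷ μ)) ≡ up ∷ downs (gap x μ) (topRow μ (width μ))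
topRow-width {m} {x} {μ} p = cong₂ _∷_
  (arrow-up (x ∷ μ) _ (zero , ℕₚ.+-comm (suc m) x))
  (begin
    topRow (x ∷ μ) (m + x)           ≡⟨ topRow-∷ x μ ℕₚ.≤-refl ⟩
    topRow μ (m + x)                 ≡⟨ cong (topRow μ) (sym (gap-width p)) ⟩
    topRow μ (gap x μ + width μ)     ≡⟨ topRow-downs (Linked.tail p) (gap x μ) ⟩
    downs (gap x μ) (topRow μ (width μ)) ∎)
  where open ≡-Reasoning

ups-downs : ∀ k w → ups (downs k w) ≡ ups w
ups-downs zero    w = refl
ups-downs (suc k) w = ups-downs k w

ups-topRow : ∀ {n} (λs : Vec ℕ n) → IsPartition λs → ups (topRow λs (width λs)) ≡ n
ups-topRow []      p = refl
ups-topRow (x ∷ μ) p = trans (cong ups (topRow-width p))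
  (cong suc (trans (ups-downs (gap x μ) _) (ups-topRow μ (Linked.tail p))))

A≡combination : ∀ {m x} {μ : Vec ℕ m} → IsPartition (x ∷ μ) →
  A (x ∷ μ) ≡ combination m (coefficient (suc m) (topRow μ (width μ))) 0 (suc (gap x μ))
A≡combination {m} {x} {μ} p = begin
  A (x ∷ μ)
    ≡⟨ A≡states (x ∷ μ) ⟩
  states (suc m) (toList (tabulate (topArrow (x ∷ μ))))
    ≡⟨ cong (states (suc m)) (trans (toList-tabulate-arrow (x ∷ μ) (width (x ∷ μ)))
                                    (topRow-width p)) ⟩
  -- As before, up entered by a right arrow unfolds like down entered by a left arrow, whence `suc`.
  transfer left (downs (suc (gap x μ)) (topRow μ (width μ))) (states m)
    ≡⟨ transfer-left-combination m _ (suc (gap x μ)) ⟩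
  combination m (coefficient (suc m) (topRow μ (width μ))) 0 (suc (gap x μ)) ∎
  where open ≡-Reasoning

-- The embedding of the naturals into the rationals.

-- Among unnormalised rationals no gcd intervenes, and the homomorphism laws become integer
-- identities.
fromℕ-ℚ-mkℚ : ∀ n → ℚ.toℚᵘ (fromℕ-ℚ n) ℚᵘ.≃ ℚᵘ.mkℚᵘ (ℤ.+ n) 0
fromℕ-ℚ-mkℚ n = ℚₚ.toℚᵘ-fromℚᵘ (ℚᵘ.mkℚᵘ (ℤ.+ n) 0)

fromℕ-ℚ-+ : ∀ a b → fromℕ-ℚ (a + b) ≡ fromℕ-ℚ a ℚ.+ fromℕ-ℚ b
fromℕ-ℚ-+ a b = ℚₚ.toℚᵘ-injective (begin
  ℚ.toℚᵘ (fromℕ-ℚ (a + b))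
    ≈⟨ fromℕ-ℚ-mkℚ (a + b) ⟩
  ℚᵘ.mkℚᵘ (ℤ.+ (a + b)) 0
    ≈⟨ ℚᵘ.*≡* (cong (ℤ._* ℤ.1ℤ) (sym (cong₂ ℤ._+_
         (ℤₚ.*-identityʳ (ℤ.+ a)) (ℤₚ.*-identityʳ (ℤ.+ b))))) ⟩
  ℚᵘ.mkℚᵘ (ℤ.+ a) 0 ℚᵘ.+ ℚᵘ.mkℚᵘ (ℤ.+ b) 0
    ≈⟨ ℚᵘₚ.+-cong (fromℕ-ℚ-mkℚ a) (fromℕ-ℚ-mkℚ b) ⟨
  ℚ.toℚᵘ (fromℕ-ℚ a) ℚᵘ.+ ℚ.toℚᵘ (fromℕ-ℚ b)
    ≈⟨ ℚₚ.toℚᵘ-homo-+ (fromℕ-ℚ a) (fromℕ-ℚ b) ⟨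
  ℚ.toℚᵘ (fromℕ-ℚ a ℚ.+ fromℕ-ℚ b) ∎)
  where open ℚᵘₚ.≃-Reasoning

fromℕ-ℚ-* : ∀ a b → fromℕ-ℚ (a * b) ≡ fromℕ-ℚ a ℚ.* fromℕ-ℚ b
fromℕ-ℚ-* a b = ℚₚ.toℚᵘ-injective (begin
  ℚ.toℚᵘ (fromℕ-ℚ (a * b))
    ≈⟨ fromℕ-ℚ-mkℚ (a * b) ⟩
  ℚᵘ.mkℚᵘ (ℤ.+ (a * b)) 0
    ≈⟨ ℚᵘ.*≡* (cong (ℤ._* ℤ.1ℤ) (ℤₚ.pos-* a b)) ⟩
  ℚᵘ.mkℚᵘ (ℤ.+ a) 0 ℚᵘ.* ℚᵘ.mkℚᵘ (ℤ.+ b) 0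
    ≈⟨ ℚᵘₚ.*-cong (fromℕ-ℚ-mkℚ a) (fromℕ-ℚ-mkℚ b) ⟨
  ℚ.toℚᵘ (fromℕ-ℚ a) ℚᵘ.* ℚ.toℚᵘ (fromℕ-ℚ b)
    ≈⟨ ℚₚ.toℚᵘ-homo-* (fromℕ-ℚ a) (fromℕ-ℚ b) ⟨
  ℚ.toℚᵘ (fromℕ-ℚ a ℚ.* fromℕ-ℚ b) ∎)
  where open ℚᵘₚ.≃-Reasoning

fromℕ-ℚ-pos : ∀ n → ℚ.Positive (fromℕ-ℚ (suc n))
fromℕ-ℚ-pos n = ℚₚ.normalize-pos (suc n) 1

fromℕ-ℚ-nonZero : ∀ n → ℚ.NonZero (fromℕ-ℚ (suc n))
fromℕ-ℚ-nonZero n = ℚₚ.pos⇒nonZero (fromℕ-ℚ (suc n)) {{fromℕ-ℚ-pos n}}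

-- Combinations as polynomials in Horner form.

eval : ∀ {n} → Vec ℚ n → ℚ → ℚ
eval ps x = Vec.foldr (λ _ → ℚ) (λ a y → a ℚ.+ x ℚ.* y) 0ℚ ps

-- The coefficients of e + (u + v x) p(x).
hornerStep : ∀ {n} → ℚ → ℚ → ℚ → Vec ℚ n → Vec ℚ (suc n)
hornerStep e u v []       = e ∷ []
hornerStep e u v (p ∷ ps) = (e ℚ.+ u ℚ.* p) ∷ hornerStep (v ℚ.* p) u v ps

eval-hornerStep : ∀ {n} e u v (ps : Vec ℚ n) x →
  eval (hornerStep e u v ps) x ≡ e ℚ.+ (u ℚ.+ v ℚ.* x) ℚ.* eval ps x
eval-hornerStep e u v [] x = solve 4 (λ e u v x →
  e :+ x :* con 0ℚ := e :+ (u :+ v :* x) :* con 0ℚ) refl e u v x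
  where open +-*-Solver
eval-hornerStep e u v (p ∷ ps) x = trans
  (cong (λ y → e ℚ.+ u ℚ.* p ℚ.+ x ℚ.* y) (eval-hornerStep (v ℚ.* p) u v ps x))
  (solve 6 (λ e u v p x y →
    e :+ u :* p :+ x :* (v :* p :+ (u :+ v :* x) :* y) :=
    e :+ (u :+ v :* x) :* (p :+ x :* y)) refl e u v p x (eval ps x))
  where open +-*-Solver

-- The last entry is the carry out of the leading coefficient, with nothing added to it.
last-hornerStep : ∀ {n} e u v (ps : Vec ℚ (suc n)) →
  last (hornerStep e u v ps) ≡ v ℚ.* last ps
last-hornerStep e u v (p ∷ [])     = refl
last-hornerStep e u v (p ∷ q ∷ ps) = last-hornerStep (v ℚ.* p) u v (q ∷ ps)

recip : ℕ → ℚ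
recip j = (ℚ.1/ fromℕ-ℚ (suc j)) {{fromℕ-ℚ-nonZero j}}

-- multichoose k (j + 1) = multichoose k j · (k + j) / (j + 1), so that
-- combination d a j k / multichoose k j is a nested product in k = x + c.
horner : ∀ (c : ℚ) d → (ℕ → ℕ) → ℕ → Vec ℚ (suc d)
horner c zero    a j = fromℕ-ℚ (a 0) ∷ []
horner c (suc d) a j =
  hornerStep (fromℕ-ℚ (a 0)) (recip j ℚ.* (fromℕ-ℚ j ℚ.+ c)) (recip j) (horner c d (a ∘ suc) (suc j))

multichoose-suc-ℚ : ∀ k j →
  fromℕ-ℚ (multichoose k (suc j)) ≡
  recip j ℚ.* (fromℕ-ℚ k ℚ.+ fromℕ-ℚ j) ℚ.* fromℕ-ℚ (multichoose k j)
multichoose-suc-ℚ k j = begin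
  M′                                     ≡⟨ ℚₚ.*-identityˡ M′ ⟨
  1ℚ ℚ.* M′                              ≡⟨ cong (ℚ._* M′) (ℚₚ.*-inverseˡ (fromℕ-ℚ (suc j)) {{fromℕ-ℚ-nonZero j}}) ⟨
  recip j ℚ.* fromℕ-ℚ (suc j) ℚ.* M′     ≡⟨ ℚₚ.*-assoc (recip j) _ M′ ⟩
  recip j ℚ.* (fromℕ-ℚ (suc j) ℚ.* M′)   ≡⟨ cong (recip j ℚ.*_) (begin
    fromℕ-ℚ (suc j) ℚ.* M′                       ≡⟨ fromℕ-ℚ-* (suc j) (multichoose k (suc j)) ⟨
    fromℕ-ℚ (suc j * multichoose k (suc j))      ≡⟨ cong fromℕ-ℚ (multichoose-absorb k j) ⟩
    fromℕ-ℚ ((k + j) * multichoose k j)          ≡⟨ fromℕ-ℚ-* (k + j) (multichoose k j) ⟩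
    fromℕ-ℚ (k + j) ℚ.* M                        ≡⟨ cong (ℚ._* M) (fromℕ-ℚ-+ k j) ⟩
    (fromℕ-ℚ k ℚ.+ fromℕ-ℚ j) ℚ.* M              ∎) ⟩
  recip j ℚ.* ((fromℕ-ℚ k ℚ.+ fromℕ-ℚ j) ℚ.* M) ≡⟨ ℚₚ.*-assoc (recip j) _ M ⟨
  recip j ℚ.* (fromℕ-ℚ k ℚ.+ fromℕ-ℚ j) ℚ.* M   ∎
  where
  open ≡-Reasoning
  M = fromℕ-ℚ (multichoose k j)
  M′ = fromℕ-ℚ (multichoose k (suc j))

-- With `multichoose k j` factored out, the factor `multichoose k (suc j)` of the tail contributes
-- one more linear factor in `x`.
eval-horner : ∀ c x k → fromℕ-ℚ k ≡ x ℚ.+ c → ∀ d a j →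
  fromℕ-ℚ (combination d a j k) ≡ fromℕ-ℚ (multichoose k j) ℚ.* eval (horner c d a j) x
eval-horner c x k k≡x+c zero a j = trans
  (fromℕ-ℚ-* (a 0) (multichoose k j))
  (solve 3 (λ a M x → a :* M := M :* (a :+ x :* con 0ℚ)) refl
    (fromℕ-ℚ (a 0)) (fromℕ-ℚ (multichoose k j)) x)
  where open +-*-Solver
eval-horner c x k k≡x+c (suc d) a j = begin
  fromℕ-ℚ (a 0 * multichoose k j + combination d (a ∘ suc) (suc j) k)
    ≡⟨ fromℕ-ℚ-+ (a 0 * multichoose k j) _ ⟩
  fromℕ-ℚ (a 0 * multichoose k j) ℚ.+ fromℕ-ℚ (combination d (a ∘ suc) (suc j) k)
    ≡⟨ cong₂ ℚ._+_ (fromℕ-ℚ-* (a 0) (multichoose k j)) (trans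
         (eval-horner c x k k≡x+c d (a ∘ suc) (suc j))
         (cong (ℚ._* E) (trans (multichoose-suc-ℚ k j)
           (cong (λ y → recip j ℚ.* (y ℚ.+ fromℕ-ℚ j) ℚ.* M) k≡x+c)))) ⟩
  fromℕ-ℚ (a 0) ℚ.* M ℚ.+ recip j ℚ.* (x ℚ.+ c ℚ.+ fromℕ-ℚ j) ℚ.* M ℚ.* E
    ≡⟨ solve 7 (λ a M v x c j E →
         a :* M :+ v :* (x :+ c :+ j) :* M :* E :=
         M :* (a :+ (v :* (j :+ c) :+ v :* x) :* E)) refl
         (fromℕ-ℚ (a 0)) M (recip j) x c (fromℕ-ℚ j) E ⟩
  M ℚ.* (fromℕ-ℚ (a 0) ℚ.+ (recip j ℚ.* (fromℕ-ℚ j ℚ.+ c) ℚ.+ recip j ℚ.* x) ℚ.* E)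
    ≡⟨ cong (M ℚ.*_) (eval-hornerStep (fromℕ-ℚ (a 0)) (recip j ℚ.* (fromℕ-ℚ j ℚ.+ c)) (recip j)
         (horner c d (a ∘ suc) (suc j)) x) ⟨
  M ℚ.* eval (horner c (suc d) a j) x ∎
  where
  open ≡-Reasoning
  open +-*-Solver
  M = fromℕ-ℚ (multichoose k j)
  E = eval (horner c d (a ∘ suc) (suc j)) x

-- The leading coefficient is `a d` times a product of positive reciprocals.
last-horner-pos : ∀ c d a j → 0 < a d → ℚ.Positive (last (horner c d a j))
last-horner-pos c zero a j 0<a with suc n ← a 0 = fromℕ-ℚ-pos n
last-horner-pos c (suc d) a j 0<a = subst ℚ.Positive
  (sym (last-hornerStep (fromℕ-ℚ (a 0)) (recip j ℚ.* (fromℕ-ℚ j ℚ.+ c)) (recip j)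
     (horner c d (a ∘ suc) (suc j))))
  (ℚₚ.pos*pos⇒pos (recip j) {{ℚₚ.1/pos⇒pos (fromℕ-ℚ (suc j)) {{fromℕ-ℚ-pos j}}}}
    (last (horner c d (a ∘ suc) (suc j))) {{last-horner-pos c d (a ∘ suc) (suc j) 0<a}})

-- The count as a polynomial in the first part.

theorem3 : ∀ (m : ℕ) (μ : Vec ℕ m) → IsPartition μ →
    Σ[ p ∈ PolynomialOfDegree m ] (∀ (λ₁ : ℕ) → IsPartition (λ₁ ∷ μ) →
    fromℕ-ℚ (A (λ₁ ∷ μ)) ≡ evaluate p (fromℕ-ℚ λ₁))
theorem3 m μ μ-partition = record { coefficients = horner c m a 0 ; leading≢0 = nonzero } ,
  λ λ₁ p → begin
    fromℕ-ℚ (A (λ₁ ∷ μ))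
      ≡⟨ cong fromℕ-ℚ (A≡combination p) ⟩
    fromℕ-ℚ (combination m a 0 (suc (gap λ₁ μ)))
      ≡⟨ eval-horner c (fromℕ-ℚ λ₁) (suc (gap λ₁ μ)) (shift λ₁ p) m a 0 ⟩
    -- The factor in front is `multichoose k 0`, which is 1.
    1ℚ ℚ.* eval (horner c m a 0) (fromℕ-ℚ λ₁)
      ≡⟨ ℚₚ.*-identityˡ _ ⟩
    eval (horner c m a 0) (fromℕ-ℚ λ₁) ∎
  where
  open ≡-Reasoning
  a = coefficient (suc m) (topRow μ (width μ))
  -- The constant by which `suc (gap λ₁ μ)` exceeds `λ₁`; it can be negative, so the subtraction is
  -- rational.
  c = fromℕ-ℚ (suc m) ℚ.- fromℕ-ℚ (width μ)

  positive : ℚ.Positive (last (horner c m a 0))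
  positive = last-horner-pos c m a 0 (leading-pos m _ (ups-topRow μ μ-partition))

  nonzero : last (horner c m a 0) ≢ 0ℚ
  nonzero eq with () ← subst ℚ.Positive eq positive

  shift : ∀ λ₁ → IsPartition (λ₁ ∷ μ) → fromℕ-ℚ (suc (gap λ₁ μ)) ≡ fromℕ-ℚ λ₁ ℚ.+ c
  shift λ₁ p = begin
    G                                       ≡⟨ solve 2 (λ G W → G := G :+ W :- W) refl G W ⟩
    G ℚ.+ W ℚ.- W                           ≡⟨ cong (ℚ._- W) (trans
      (sym (fromℕ-ℚ-+ (suc (gap λ₁ μ)) (width μ)))
      (trans (cong (fromℕ-ℚ ∘ suc) (gap-width p)) (fromℕ-ℚ-+ (suc m) λ₁))) ⟩
    fromℕ-ℚ (suc m) ℚ.+ fromℕ-ℚ λ₁ ℚ.- W    ≡⟨ solve 3 (λ n l W →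
      n :+ l :- W := l :+ (n :- W)) refl (fromℕ-ℚ (suc m)) (fromℕ-ℚ λ₁) W ⟩
    fromℕ-ℚ λ₁ ℚ.+ c                        ∎
    where
    open +-*-Solver
    G = fromℕ-ℚ (suc (gap λ₁ μ))
    W = fromℕ-ℚ (width μ)
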